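{- If $(f,g)$ is a binding pair, then $g(k)\ge k-1$ for all $k\in\mathbb{N}$.
   Context: Graphs are finite and simple. The cycle spectrum of a graph $G$ is $\Lambda(G)=\{\ell\in\mathbb{N}\mid G\text{ contains a cycle of length }\ell\}$. Let $f,g:\mathbb{N}\to\mathbb{R}$ be functions. The pair $(f,g)$ is a binding pair if for all $k\in\mathbb{N}$, every graph $G$ contains $k$ vertex-disjoint cycles of pairwise distinct lengths, or a set $X$ of at most $f(k)$ vertices such that $|\Lambda(G-X)|\le g(k)$. -}

module Defs where

open import Data.Fin.Base using (Fin; zero; suc; inject₁; fromℕ)
open import Data.Fin.Subset using (Subset; ∣_∣)
open import Data.Fin.Subset.Properties using (_∈?_)
open import Data.Integer.Base as ℤ using (ℤ; +_)
open import Data.List.Base using (List; length; lookup; filter; allFin)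
open import Data.List.Membership.Propositional using (_∈_)
open import Data.List.Relation.Unary.Unique.Propositional using (Unique)
open import Data.Nat.Base as ℕ using (ℕ; NonZero)
open import Data.Product.Base using (Σ-syntax; ∃-syntax; _×_; _,_)
open import Data.Rational.Base as ℚ using (ℚ; 1ℚ)
import Data.Rational.Properties as ℚ
open import Data.Sum.Base using (_⊎_; inj₁; inj₂)
open import Function.Bundles using (_⇔_; mk⇔)
open import Function.Definitions using (Injective)
open import Level using (0ℓ)
open import Relation.Binary.Core using (Rel)
open import Relation.Binary.Definitions using (Decidable; Irreflexive; Symmetric; tri<; tri≈; tri>)
open import Relation.Binary.PropositionalEquality using (_≡_; _≢_; refl; subst)
open import Relation.Nullary.Decidable using (¬?)
open import Relation.Nullary.Negation using (¬_)
open import Relation.Unary using (Pred)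

------------------------------------------------------------------------
-- Real numbers

-- Two-sided Dedekind cuts of ℚ: Lower p means p < x, Upper p means x < p.
-- The order is inclusion of lower cuts; equality of reals, which is not
-- needed here, would be ≤ in both directions.

record ℝ : Set₁ where
  field
    Lower Upper     : Pred ℚ 0ℓ
    lower-inhabited : ∃[ p ] Lower p
    upper-inhabited : ∃[ p ] Upper p
    lower-rounded   : ∀ p → Lower p ⇔ (∃[ q ] p ℚ.< q × Lower q)
    upper-rounded   : ∀ q → Upper q ⇔ (∃[ p ] p ℚ.< q × Upper p)
    disjoint        : ∀ p → ¬ (Lower p × Upper p)
    located         : ∀ p q → p ℚ.< q → Lower p ⊎ Upper q

open ℝ public using (Lower; Upper)

infix 4 _≤ℝ_

_≤ℝ_ : ℝ → ℝ → Set
x ≤ℝ y = ∀ p → Lower x p → Lower y p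

fromℚ : ℚ → ℝ
fromℚ r = record
  { Lower           = ℚ._< r
  ; Upper           = r ℚ.<_
  ; lower-inhabited = r ℚ.- 1ℚ , subst (r ℚ.- 1ℚ ℚ.<_) (ℚ.+-identityʳ r)
                        (ℚ.+-monoʳ-< r (ℚ.negative⁻¹ (ℚ.- 1ℚ)))
  ; upper-inhabited = r ℚ.+ 1ℚ , subst (ℚ._< r ℚ.+ 1ℚ) (ℚ.+-identityʳ r)
                        (ℚ.+-monoʳ-< r (ℚ.positive⁻¹ 1ℚ))
  ; lower-rounded   = λ p → mk⇔ (λ p<r → let q , p<q , q<r = ℚ.<-dense p<r in q , p<q , q<r)
                                (λ (q , p<q , q<r) → ℚ.<-trans p<q q<r)
  ; upper-rounded   = λ q → mk⇔ (λ r<q → let p , r<p , p<q = ℚ.<-dense r<q in p , p<q , r<p)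
                                (λ (p , p<q , r<p) → ℚ.<-trans r<p p<q)
  ; disjoint        = λ p (p<r , r<p) → ℚ.<-asym p<r r<p
  ; located         = λ p q p<q → locate p q p<q
  }
  where
  locate : ∀ p q → p ℚ.< q → p ℚ.< r ⊎ r ℚ.< q
  locate p q p<q with ℚ.<-cmp p r
  ... | tri< p<r _ _    = inj₁ p<r
  ... | tri≈ _ refl _   = inj₂ p<q
  ... | tri> _ _ r<p    = inj₂ (ℚ.<-trans r<p p<q)

fromℤ : ℤ → ℝ
fromℤ i = fromℚ (i ℚ./ 1)

------------------------------------------------------------------------
-- Finite simple graphs

record Graph : Set₁ where
  field
    order  : ℕ
    Adj    : Rel (Fin order) 0ℓ
    adj?   : Decidable Adj
    irrefl : Irreflexive _≡_ Adj
    sym    : Symmetric Adj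

open Graph public using (order; Adj)

Vertex : Graph → Set
Vertex G = Fin (order G)

-- The induced subgraph on the complement of X. The i-th vertex of G - X
-- is the i-th vertex of G not belonging to X.

remaining : (G : Graph) → Subset (order G) → List (Vertex G)
remaining G X = filter (λ v → ¬? (v ∈? X)) (allFin (order G))

infixl 6 _-_

_-_ : (G : Graph) → Subset (order G) → Graph
G - X = record
  { order  = length vs
  ; Adj    = λ i j → Adj G (lookup vs i) (lookup vs j)
  ; adj?   = λ i j → Graph.adj? G (lookup vs i) (lookup vs j)
  ; irrefl = λ { refl → Graph.irrefl G refl }
  ; sym    = Graph.sym G
  }
  where vs = remaining G X

-- A cycle v₀ v₁ … v₂₊ₑ v₀ with distinct vertices. Its length is 3 + excess,
-- as cycles of a simple graph have at least three vertices.

record Cycle (G : Graph) : Set where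
  field
    excess : ℕ

  size : ℕ
  size = 3 ℕ.+ excess

  field
    vertex   : Fin size → Vertex G
    distinct : Injective _≡_ _≡_ vertex
    step     : (i : Fin (2 ℕ.+ excess)) → Adj G (vertex (inject₁ i)) (vertex (suc i))
    close    : Adj G (vertex (fromℕ (2 ℕ.+ excess))) (vertex zero)

open Cycle public using (size; vertex)

VertexDisjoint : {G : Graph} → Cycle G → Cycle G → Set
VertexDisjoint C D = ∀ i j → vertex C i ≢ vertex D j

-- The cycle spectrum.

Λ : Graph → Pred ℕ 0ℓ
Λ G ℓ = Σ[ C ∈ Cycle G ] size C ≡ ℓ

DisjointCyclesOfDistinctLengths : ℕ → Graph → Set
DisjointCyclesOfDistinctLengths k G =
  Σ[ C ∈ (Fin k → Cycle G) ]
    (∀ i j → i ≢ j → VertexDisjoint (C i) (C j) × size (C i) ≢ size (C j))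

------------------------------------------------------------------------
-- Binding pairs

HasCardinality : Pred ℕ 0ℓ → ℕ → Set
HasCardinality S c =
  Σ[ xs ∈ List ℕ ] Unique xs × (∀ ℓ → ℓ ∈ xs ⇔ S ℓ) × length xs ≡ c

CardinalityAtMost : Pred ℕ 0ℓ → ℝ → Set
CardinalityAtMost S x = ∃[ c ] HasCardinality S c × fromℤ (+ c) ≤ℝ x

-- Here ℕ means the positive integers, so the values of f and g at 0 are
-- irrelevant. (Zero cycles always exist, so k = 0 would not constrain g.)

IsBindingPair : (f g : ℕ → ℝ) → Set₁
IsBindingPair f g =
  ∀ k → .{{NonZero k}} → (G : Graph) →
    DisjointCyclesOfDistinctLengths k G
    ⊎ Σ[ X ∈ Subset (order G) ]
        fromℤ (+ ∣ X ∣) ≤ℝ f k × CardinalityAtMost (Λ (G - X)) (g k)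

{-# OPTIONS --safe #-}
-- Fix k and a bound M on the number of deleted vertices, and let G consist of
-- M disjoint copies of the complete graph on k + 1 vertices. A cycle stays in
-- one copy, so its length is one of the k - 1 numbers 3, …, k + 1, and k cycles
-- cannot have distinct lengths. Deleting fewer than M vertices leaves some copy
-- intact, and that copy contains cycles of all k - 1 lengths.
module Submission where

open import Defs
open import Data.Nat.Base using (ℕ; NonZero)
open import Data.Integer.Base as ℤ using (+_; 1ℤ)

open import Data.Empty using (⊥-elim)
open import Data.Fin.Base
  using (Fin; zero; suc; toℕ; fromℕ<; inject₁; inject≤; combine; quotient; remainder)
import Data.Fin.Properties as Fin
open import Data.Fin.Subset using (Subset; ∣_∣; _∈_; _∉_)
open import Data.Fin.Subset.Properties using (_∈?_; x∈p∧x≢y⇒x∈p-y; x∈p⇒∣p-x∣<∣p∣)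
import Data.Integer.Properties as ℤ
open import Data.List.Base using (lookup)
import Data.List.Membership.Propositional as List
open import Data.List.Membership.Propositional.Properties using (∈-filter⁺; ∈-allFin)
import Data.List.Membership.Setoid.Properties as Membership
open import Data.List.Relation.Unary.Any using (index)
open import Data.List.Relation.Unary.Any.Properties using (lookup-index)
open import Data.Nat.Base using (zero; suc; _+_; _*_; _≤_; _<_; z≤n; s≤s; s≤s⁻¹)
import Data.Nat.Properties as ℕ
open import Data.Product.Base using (_×_; _,_; proj₁; proj₂; ∃-syntax)
open import Data.Rational.Base as ℚ using (mkℚ; *≤*)
import Data.Rational.Literals as Literals
import Data.Rational.Properties as ℚ
open import Data.Sum.Base using (inj₁; inj₂)
open import Function.Base using (_∘_)
open import Function.Bundles using (Equivalence)
open import Function.Definitions using (Injective)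
open import Relation.Binary.PropositionalEquality
  using (_≡_; _≢_; refl; sym; trans; cong; cong₂; subst; subst₂; setoid)
open import Relation.Nullary.Decidable using (yes; no; ¬?; _×-dec_; decidable-stable)
open import Relation.Nullary.Negation using (¬_)

-- `i ℚ./ 1` normalises by a gcd and is stuck for a variable `i`; the literal exposes its numerator
-- and denominator.
/1-fromℤ : ∀ i → i ℚ./ 1 ≡ Literals.fromℤ i
/1-fromℤ i = ℚ.↥p/↧p≡p (Literals.fromℤ i)

/1-mono-≤ : ∀ {i j} → i ℤ.≤ j → i ℚ./ 1 ℚ.≤ j ℚ./ 1
/1-mono-≤ {i} {j} i≤j =
  subst₂ ℚ._≤_ (sym (/1-fromℤ i)) (sym (/1-fromℤ j)) (*≤* (ℤ.*-monoʳ-≤-nonNeg 1ℤ i≤j))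

fromℤ-mono-≤ : ∀ {i j} → i ℤ.≤ j → fromℤ i ≤ℝ fromℤ j
fromℤ-mono-≤ i≤j p p<i = ℚ.<-≤-trans p<i (/1-mono-≤ i≤j)

p≤∣↥p∣ : ∀ p → p ℚ.≤ + ℤ.∣ ℚ.↥ p ∣ ℚ./ 1
p≤∣↥p∣ p = subst (p ℚ.≤_) (sym (/1-fromℤ _)) (bound p)
  where
  bound : ∀ p → p ℚ.≤ Literals.fromℤ (+ ℤ.∣ ℚ.↥ p ∣)
  bound (mkℚ (+ n) d _)      = *≤* (ℤ.*-monoˡ-≤-nonNeg (+ n) (ℤ.+≤+ (s≤s z≤n)))
  bound (mkℚ ℤ.-[1+ n ] d _) = *≤* ℤ.-≤+

-- `M` is the absolute numerator of a rational `p` above `x`, so `p ≤ M`. It will serve as the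
-- number of cliques.
archimedean : ∀ x → ∃[ M ] (∀ n → fromℤ (+ n) ≤ℝ x → n < M)
archimedean x with ℝ.upper-inhabited x
... | p , x<p = M , bounded
  where
  M = ℤ.∣ ℚ.↥ p ∣

  bounded : ∀ n → fromℤ (+ n) ≤ℝ x → n < M
  bounded n n≤x with n ℕ.<? M
  ... | yes n<M = n<M
  ... | no  n≮M =
    -- Lower cuts are strict and `p` may equal `n`, so a rational `q` strictly between `x` and `p`
    -- is taken; it would lie in both cuts of `x`.
    let q , q<p , x<q = Equivalence.to (ℝ.upper-rounded x p) x<p
        p≤n = ℚ.≤-trans (p≤∣↥p∣ p) (/1-mono-≤ (ℤ.+≤+ (ℕ.≮⇒≥ n≮M)))
    in ⊥-elim (ℝ.disjoint x q (n≤x q (ℚ.<-≤-trans q<p p≤n) , x<q))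

-- Induction on `m`: removing `f zero` from `X` keeps the other values and lowers the cardinality.
injection-into-subset : ∀ {m n} (X : Subset n) (f : Fin m → Fin n) →
                        Injective _≡_ _≡_ f → (∀ i → f i ∈ X) → m ≤ ∣ X ∣
injection-into-subset {zero}  X f f-inj f∈X = z≤n
injection-into-subset {suc m} X f f-inj f∈X = ℕ.≤-trans
  (s≤s (injection-into-subset _ (f ∘ suc) (Fin.suc-injective ∘ f-inj)
    (λ i → x∈p∧x≢y⇒x∈p-y (f∈X (suc i)) (Fin.0≢1+n ∘ sym ∘ f-inj))))
  (x∈p⇒∣p-x∣<∣p∣ (f∈X zero))

-- Otherwise one element of `X` chosen in each block would give `M` distinct elements of `X`.
missed-block : ∀ M n (X : Subset (M * n)) → ∣ X ∣ < M →
               ∃[ c ] (∀ (r : Fin n) → combine {M} c r ∉ X)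
missed-block M n X ∣X∣<M
  with Fin.any? {n = M} (λ c → Fin.all? (λ (r : Fin n) → ¬? (combine c r ∈? X)))
... | yes missed = missed
... | no  hit    =
  ⊥-elim (ℕ.<⇒≱ ∣X∣<M (injection-into-subset X (λ c → combine c (witness c))
    (λ {c} {d} → Fin.combine-injectiveˡ c _ d _) (proj₂ ∘ hits)))
  where
  hits : ∀ c → ∃[ r ] combine {M} {n} c r ∈ X
  hits c = decidable-stable (Fin.any? (λ r → combine c r ∈? X))
    (λ none → hit (c , λ r r∈X → none (r , r∈X)))

  witness : Fin M → Fin n
  witness = proj₁ ∘ hits

-- `quotient` gives the copy that a vertex belongs to, `remainder` its position there, and `combine`
-- rebuilds the vertex from both.
cliques : ℕ → ℕ → Graph
cliques M n = record
  { order  = M * n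
  ; Adj    = λ u v → u ≢ v × quotient {M} n u ≡ quotient n v
  ; adj?   = λ u v → ¬? (u Fin.≟ v) ×-dec (quotient n u Fin.≟ quotient n v)
  ; irrefl = λ u≡v (u≢v , _) → u≢v u≡v
  ; sym    = λ (u≢v , same) → u≢v ∘ sym , sym same
  }

constant : ∀ {n} {A : Set} (f : Fin (suc n) → A) →
           (∀ i → f (inject₁ i) ≡ f (suc i)) → ∀ i → f zero ≡ f i
constant         f step zero    = refl
constant {suc n} f step (suc i) = trans (step zero) (constant (f ∘ suc) (step ∘ suc) i)

-- Steps preserve the quotient, so the distinct vertices of a cycle must differ in their remainders.
cliques-size≤ : ∀ M n (C : Cycle (cliques M n)) → size C ≤ n
cliques-size≤ M n C = Fin.injective⇒≤ {f = remainder {M} n ∘ vertex C} position-injective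
  where
  component : ∀ i → quotient {M} n (vertex C zero) ≡ quotient n (vertex C i)
  component = constant (quotient n ∘ vertex C) (proj₂ ∘ Cycle.step C)

  position-injective : Injective _≡_ _≡_ (remainder {M} n ∘ vertex C)
  position-injective {i} {j} same = Cycle.distinct C
    (trans (sym (Fin.combine-remQuot {M} n (vertex C i)))
    (trans (cong₂ combine (trans (sym (component i)) (component j)) same)
           (Fin.combine-remQuot {M} n (vertex C j))))

-- Sizes lie between 3 and `2 + m`, so `suc m` cycles share only `m` possible excesses.
¬disjoint-cycles : ∀ M m → ¬ DisjointCyclesOfDistinctLengths (suc m) (cliques M (2 + m))
¬disjoint-cycles M m (C , C-distinct) =
  let i , j , i<j , same = Fin.pigeonhole (ℕ.n<1+n m) (λ i → fromℕ< (excess< i))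
  in proj₂ (C-distinct i j (Fin.<⇒≢ i<j))
       (cong (λ e → 3 + e) (Fin.fromℕ<-injective _ _ (excess< i) (excess< j) same))
  where
  excess< : ∀ i → Cycle.excess (C i) < m
  excess< i = s≤s⁻¹ (s≤s⁻¹ (cliques-size≤ M (2 + m) (C i)))

inject₁≢suc : ∀ {n} {i : Fin n} → inject₁ i ≢ suc i
inject₁≢suc {i = suc i} = inject₁≢suc ∘ Fin.suc-injective

-- The first `3 + e` positions of the intact copy, in order, form a cycle, as any two of its
-- vertices are adjacent.
missed-clique-cycle : ∀ M n (X : Subset (M * n)) c → (∀ (r : Fin n) → combine {M} c r ∉ X) →
                      ∀ e → 3 + e ≤ n → Λ (cliques M n - X) (3 + e)
missed-clique-cycle M n X c missed e 3+e≤n = record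
  { excess   = e
  ; vertex   = place
  ; distinct = place-injective
  ; step     = λ i → adjacent inject₁≢suc
  ; close    = adjacent (λ ())
  } , refl
  where
  G : Graph
  G = cliques M n

  target : Fin (3 + e) → Vertex G
  target i = combine c (inject≤ i 3+e≤n)

  kept : ∀ i → target i List.∈ remaining G X
  kept i = ∈-filter⁺ (λ v → ¬? (v ∈? X)) (∈-allFin (target i)) (missed _)

  -- Deletion renumbers the vertices: the new number of `target i` is its index in the list of
  -- remaining ones.
  place : Fin (3 + e) → Vertex (G - X)
  place i = index (kept i)

  target-place : ∀ i → target i ≡ lookup (remaining G X) (place i)
  target-place i = lookup-index (kept i)

  target-injective : Injective _≡_ _≡_ target
  target-injective {i} {j} same =
    Fin.inject≤-injective _ _ i j (Fin.combine-injectiveʳ c _ c _ same)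

  place-injective : Injective _≡_ _≡_ place
  place-injective {i} {j} same = target-injective
    (trans (target-place i) (trans (cong (lookup (remaining G X)) same) (sym (target-place j))))

  target-component : ∀ i → quotient {M} n (target i) ≡ c
  target-component i = cong proj₁ (Fin.remQuot-combine c (inject≤ i 3+e≤n))

  adjacent : ∀ {i j} → i ≢ j → Adj (G - X) (place i) (place j)
  adjacent {i} {j} i≢j = subst₂ (Adj G) (target-place i) (target-place j)
    (i≢j ∘ target-injective , trans (target-component i) (sym (target-component j)))

-- Distinct values of `f` occupy distinct positions in the list of length `c` that enumerates `S`.
injection-into-predicate : ∀ {S m c} (f : Fin m → ℕ) → Injective _≡_ _≡_ f →
                           (∀ i → S (f i)) → HasCardinality S c → m ≤ c
injection-into-predicate f f-inj f∈S (xs , _ , xs⇔S , refl) =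
  Fin.injective⇒≤ {f = index ∘ listed}
    (λ {i} {j} same → f-inj (Membership.index-injective (setoid ℕ) (listed i) (listed j) same))
  where
  listed : ∀ i → f i List.∈ xs
  listed i = Equivalence.from (xs⇔S (f i)) (f∈S i)

theorem3p1 : (f g : ℕ → ℝ) → IsBindingPair f g → ∀ k → .{{NonZero k}} → fromℤ (+ k ℤ.- 1ℤ) ≤ℝ g k
theorem3p1 f g binding (suc m) with archimedean (f (suc m))
... | M , bounded with binding (suc m) (cliques M (2 + m))
...   | inj₁ cycles = ⊥-elim (¬disjoint-cycles M m cycles)
...   | inj₂ (X , ∣X∣≤f , c , Λ-card , c≤g) =
  -- For `k = suc m` the integer `k - 1` computes to `m`.
  λ p p<m → c≤g p (fromℤ-mono-≤ (ℤ.+≤+ m≤c) p p<m)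
  where
  m≤c : m ≤ c
  m≤c =
    let b , missed = missed-block M (2 + m) X (bounded ∣ X ∣ ∣X∣≤f)
    -- As `i` runs through `Fin m`, `3 + toℕ i` takes the lengths from 3 to the clique order
    -- `2 + m`.
    in injection-into-predicate (λ i → 3 + toℕ i)
         (Fin.toℕ-injective ∘ ℕ.+-cancelˡ-≡ 3 _ _)
         (λ i → missed-clique-cycle M (2 + m) X b missed (toℕ i) (s≤s (s≤s (Fin.toℕ<n i))))
         Λ-card
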